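{- $\mathrm{EF}$ model checking is decidable for gap-order constraint systems: given a GCS $\mathcal{G}$, a valuation $\nu$ and an $\mathrm{EF}$ formula $\psi$, it is decidable whether $\nu\in[\![\psi]\!]$. Moreover, for every $\mathrm{EF}$ formula $\psi$ the set $[\![\psi]\!]$ is effectively gap definable, i.e.\ a gap formula $\varphi$ with $\mathit{Sat}(\varphi)=[\![\psi]\!]$ can be computed from $\mathcal{G}$ and $\psi$.
   Context: Fix finite sets $\mathit{Var}$ of variables (ranging over $\mathbb{Z}$) and $\mathit{Const}\subseteq\mathbb{Z}$ of constants. A valuation is a map $\nu:\mathit{Var}\to\mathbb{Z}$, extended by $\nu(c)=c$ for constants; $\mathit{Val}$ is the set of valuations. A gap clause is an inequation $x-y\ge k$ with $x,y\in\mathit{Var}\cup\mathit{Const}$, $k\in\mathbb{Z}$; positive if $k\in\mathbb{N}$; $\nu$ satisfies it iff $\nu(x)-\nu(y)\ge k$. A gap formula is an arbitrary Boolean combination of gap clauses; $\mathit{Sat}(\varphi)$ is the set of valuations satisfying it; a set is gap definable if it equals $\mathit{Sat}(\varphi)$ for some gap formula $\varphi$. A (positive) gap constraint is a finite conjunction of (positive) gap clauses. Let $\mathit{Var}'=\{x'\mid x\in\mathit{Var}\}$; a transitional gap constraint is one over $\mathit{Var}\cup\mathit{Var}'$, and $\nu\oplus\nu'$ maps $x\mapsto\nu(x)$, $x'\mapsto\nu'(x)$. A GCS is $\mathcal{G}=(\mathit{Var},\mathit{Const},\mathit{Act},\Delta,\lambda)$ with finite action set $\mathit{Act}$, finite set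 $\Delta$ of positive transitional gap constraints and $\lambda:\Delta\to\mathit{Act}$; its semantics is the transition system on $\mathit{Val}$ with $\nu\xrightarrow{a}\nu'$ iff $\nu\oplus\nu'$ satisfies some $C\in\Delta$ with $\lambda(C)=a$. $\mathrm{EF}$ formulae: $\psi::=C\mid\mathit{true}\mid\neg\psi\mid\psi\wedge\psi\mid\langle a\rangle\psi\mid\mathrm{EF}\,\psi$ with $C$ a gap clause and $a\in\mathit{Act}$. Semantics: $[\![C]\!]=\mathit{Sat}(C)$, $[\![\mathit{true}]\!]=\mathit{Val}$, negation/conjunction are complement/intersection, $[\![\langle a\rangle\psi]\!]=\{\nu\mid\exists\nu'\in[\![\psi]\!].\ \nu\xrightarrow{a}\nu'\}$, and $[\![\mathrm{EF}\,\psi]\!]$ is the set of $\nu$ from which some valuation in $[\![\psi]\!]$ is reachable by a finite (possibly empty) sequence of steps. -}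

module Defs where

open import Data.Nat using (ℕ)
open import Data.Integer using (ℤ; _-_; _≥_; +_; +0)
open import Data.Fin using (Fin)
open import Data.Vec using (Vec; lookup)
open import Data.List using (List)
open import Data.List.Relation.Unary.All using (All)
open import Data.List.Relation.Unary.Any using (Any)
open import Data.Product using (Σ; ∃; _×_; _,_; proj₁; proj₂)
open import Data.Sum using (_⊎_; inj₁; inj₂)
open import Data.Unit using (⊤)
open import Relation.Nullary using (¬_)
open import Relation.Binary.PropositionalEquality using (_≡_)
open import Relation.Binary.Construct.Closure.ReflexiveTransitive using (Star)

-- Terms over a set V of variables and m constants (indices into a constant table).
data Term (V : Set) (m : ℕ) : Set where
  var : V → Term V m
  cst : Fin m → Term V m

record GapClause (V : Set) (m : ℕ) : Set where
  constructor gap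
  field
    lhs : Term V m
    rhs : Term V m
    bound : ℤ

Positive : ∀ {V m} → GapClause V m → Set
Positive c = GapClause.bound c ≥ +0

evalT : ∀ {V m} → Vec ℤ m → (V → ℤ) → Term V m → ℤ
evalT cs ν (var x) = ν x
evalT cs ν (cst c) = lookup cs c

SatClause : ∀ {V m} → Vec ℤ m → (V → ℤ) → GapClause V m → Set
SatClause cs ν (gap x y k) = (evalT cs ν x - evalT cs ν y) ≥ k

data GapFormula (V : Set) (m : ℕ) : Set where
  tt   : GapFormula V m
  cl   : GapClause V m → GapFormula V m
  neg  : GapFormula V m → GapFormula V m
  conj : GapFormula V m → GapFormula V m → GapFormula V m

Sat : ∀ {V m} → Vec ℤ m → GapFormula V m → (V → ℤ) → Set
Sat cs tt ν = ⊤
Sat cs (cl c) ν = SatClause cs ν c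
Sat cs (neg φ) ν = ¬ Sat cs φ ν
Sat cs (conj φ ψ) ν = Sat cs φ ν × Sat cs ψ ν

GapConstraint : Set → ℕ → Set
GapConstraint V m = List (GapClause V m)

SatConstraint : ∀ {V m} → Vec ℤ m → (V → ℤ) → GapConstraint V m → Set
SatConstraint cs ν C = All (SatClause cs ν) C

-- Var = Fin n, Var' a second copy: transitional constraints are over Fin n ⊎ Fin n
-- (inj₁ x stands for x, inj₂ x stands for x').
TransConstraint : ℕ → ℕ → Set
TransConstraint n m = GapConstraint (Fin n ⊎ Fin n) m

_⊕_ : ∀ {n} → (Fin n → ℤ) → (Fin n → ℤ) → (Fin n ⊎ Fin n → ℤ)
(ν ⊕ ν') (inj₁ x) = ν x
(ν ⊕ ν') (inj₂ x) = ν' x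

-- A GCS: n variables, constants table consts (Const = its entries),
-- actions Fin nAct, Δ a finite list of positive transitional gap constraints
-- each paired with its label λ(C).
record GCS : Set where
  field
    n      : ℕ
    m      : ℕ
    consts : Vec ℤ m
    nAct   : ℕ
    Δ      : List (TransConstraint n m × Fin nAct)
    positive : All (λ Ca → All Positive (proj₁ Ca)) Δ

module _ (G : GCS) where
  open GCS G

  Val : Set
  Val = Fin n → ℤ

  Act : Set
  Act = Fin nAct

  Step : Act → Val → Val → Set
  Step a ν ν' = Any (λ Ca → SatConstraint consts (ν ⊕ ν') (proj₁ Ca) × proj₂ Ca ≡ a) Δ

  AnyStep : Val → Val → Set
  AnyStep ν ν' = ∃ λ a → Step a ν ν'

  Reach : Val → Val → Set
  Reach = Star AnyStep

  data EF : Set where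
    clause : GapClause (Fin n) m → EF
    true   : EF
    ¬EF    : EF → EF
    _∧EF_  : EF → EF → EF
    ⟨_⟩_   : Act → EF → EF
    EF⟨_⟩  : EF → EF

  ⟦_⟧ : EF → Val → Set
  ⟦ clause c ⟧ ν = SatClause consts ν c
  ⟦ true ⟧ ν = ⊤
  ⟦ ¬EF ψ ⟧ ν = ¬ ⟦ ψ ⟧ ν
  ⟦ ψ ∧EF χ ⟧ ν = ⟦ ψ ⟧ ν × ⟦ χ ⟧ ν
  ⟦ ⟨ a ⟩ ψ ⟧ ν = Σ Val λ ν' → Step a ν ν' × ⟦ ψ ⟧ ν'
  ⟦ EF⟨ ψ ⟩ ⟧ ν = Σ Val λ ν' → Reach ν ν' × ⟦ ψ ⟧ ν'

{-# OPTIONS --safe #-}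
module Submission where

-- An expanding map f : ℤ → ℤ that fixes the constants turns steps of the GCS
-- into steps, since positive clauses only bound nonnegative differences from
-- below.  Let K bound the constants in φ, and let ν ⊑ μ mean that ν and μ order
-- the terms alike, with equal gaps up to some B and gaps at least as large in μ
-- beyond.  If B is large compared with K, then for every ν′ satisfying φ some
-- such f maps ν to μ and keeps f ∘ ν′ in Sat φ: a gap of ν longer than B contains
-- a subgap longer than K free of values of ν′, and all the expansion goes there.
-- Hence the sets of valuations that reach Sat φ within i steps are all ⊑-upward
-- closed.  As ⊑ is almost full, this increasing chain stabilises; each member is
-- gap definable by quantifier elimination, which also decides stabilisation.

open import Defs
open import Data.Empty using (⊥)
open import Data.Fin using (Fin; zero; suc; _≟_)
open import Data.Integer using (ℤ; +_; -[1+_]; _+_; _-_; -_; _≤_; _≤?_; 0ℤ; 1ℤ; -1ℤ; pred; _⊔_; ∣_∣; +≤+; -≤+)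
import Data.Integer.Properties as ℤ
open import Data.Integer.Tactic.RingSolver using (solve-∀)
open import Data.List using (List; []; _∷_; _++_; map; foldr; filter; length; allFin)
open import Data.List.Extrema ℤ.≤-totalOrder using (min; max; min≤xs; xs≤max; max≤v⁺; ⊥≤max)
open import Data.List.Properties using (length-map)
open import Data.List.Membership.Propositional using (_∈_; lose)
open import Data.List.Membership.Propositional.Properties using (∈-++⁺ˡ; ∈-++⁺ʳ; ∈-map⁺; ∈-filter⁺; ∈-allFin)
open import Data.List.Relation.Unary.All as All using (All; []; _∷_)
import Data.List.Relation.Unary.All.Properties as All
open import Data.List.Relation.Unary.Any as Any using (Any; here; there)
import Data.List.Relation.Unary.Any.Properties as Any
open import Data.Maybe using (Maybe; just; nothing; maybe′)
open import Data.Nat as ℕ using (ℕ; zero; suc)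
open import Data.Nat.Induction using (<-wellFounded)
import Data.Nat.Properties as ℕ
open import Data.Product using (Σ; ∃; _×_; _,_; proj₁; proj₂)
open import Data.Product.Function.NonDependent.Propositional using (_×-⇔_)
open import Data.Sum as Sum using (_⊎_; inj₁; inj₂; [_,_]; [_,_]′)
open import Data.Sum.Function.Propositional using (_⊎-⇔_)
open import Data.Unit using (tt)
open import Data.Vec using (Vec; lookup)
open import Function using (_∘_; id)
open import Function.Bundles using (_⇔_; mk⇔; Equivalence)
open import Function.Properties.Equivalence using () renaming (refl to ⇔-refl; trans to ⇔-trans)
open import Function.Related.TypeIsomorphisms using (¬-cong-⇔)
open import Induction.WellFounded using (Acc; acc)
open import Relation.Binary.Construct.Closure.ReflexiveTransitive using (ε; _◅_)
open import Relation.Binary.PropositionalEquality using (_≡_; _≗_; refl; sym; trans; cong; cong₂; subst; subst₂)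
open import Relation.Nullary using (Dec; yes; no; ¬_; contradiction; ¬?; _×-dec_)
open import Relation.Nullary.Decidable using (decidable-stable) renaming (map to Dec-map)

open Equivalence using (to; from)

-- Transfer of equivalences and inequalities.

≡⇒⇔ : {A B : Set} → A ≡ B → A ⇔ B
≡⇒⇔ refl = ⇔-refl

-- Linear inequalities are carried along an identity between two differences, which leaves only ring
-- equations to check.
nonneg-diff : ∀ {a b} → a ≤ b → ∀ {c d} → b - a ≡ d - c → c ≤ d
nonneg-diff a≤b eq = ℤ.0≤i-j⇒j≤i (subst (0ℤ ≤_) eq (ℤ.i≤j⇒0≤j-i a≤b))

nonneg-diff-⇔ : ∀ {a b c d} → b - a ≡ d - c → (a ≤ b) ⇔ (c ≤ d)
nonneg-diff-⇔ eq = mk⇔ (λ p → nonneg-diff p eq) (λ p → nonneg-diff p (sym eq))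

-- Decidability and extensionality of satisfaction.

module _ {m : ℕ} (cs : Vec ℤ m) where

  sat? : ∀ {V} (φ : GapFormula V m) ν → Dec (Sat cs φ ν)
  sat? tt ν = yes tt
  sat? (cl (gap s t k)) ν = k ≤? (evalT cs ν s - evalT cs ν t)
  sat? (neg φ) ν = ¬? (sat? φ ν)
  sat? (conj φ ψ) ν = sat? φ ν ×-dec sat? ψ ν

  evalT-cong : ∀ {V} {ν μ : V → ℤ} → ν ≗ μ → evalT cs ν ≗ evalT cs μ
  evalT-cong eq (var x) = eq x
  evalT-cong eq (cst c) = refl

  Sat-cong : ∀ {V} {ν μ : V → ℤ} → ν ≗ μ → ∀ φ → Sat cs φ ν ⇔ Sat cs φ μ
  Sat-cong eq tt = ⇔-refl
  Sat-cong eq (cl (gap s t k)) =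
    ≡⇒⇔ (cong₂ (λ a b → k ≤ a - b) (evalT-cong eq s) (evalT-cong eq t))
  Sat-cong eq (neg φ) = ¬-cong-⇔ (Sat-cong eq φ)
  Sat-cong eq (conj φ ψ) = Sat-cong eq φ ×-⇔ Sat-cong eq ψ

-- Derived connectives and renaming.

ff : ∀ {V m} → GapFormula V m
ff = neg tt

_or_ : ∀ {V m} → GapFormula V m → GapFormula V m → GapFormula V m
φ or ψ = neg (conj (neg φ) (neg ψ))

⋁ : ∀ {V m} {A : Set} → (A → GapFormula V m) → List A → GapFormula V m
⋁ F = foldr (λ a φ → F a or φ) ff

⋀ : ∀ {V m} → GapConstraint V m → GapFormula V m
⋀ = foldr (λ c φ → conj (cl c) φ) tt

renameT : ∀ {V W : Set} {m} → (V → W) → Term V m → Term W m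
renameT ρ (var x) = var (ρ x)
renameT ρ (cst c) = cst c

rename : ∀ {V W : Set} {m} → (V → W) → GapFormula V m → GapFormula W m
rename ρ tt = tt
rename ρ (cl (gap s t k)) = cl (gap (renameT ρ s) (renameT ρ t) k)
rename ρ (neg φ) = neg (rename ρ φ)
rename ρ (conj φ ψ) = conj (rename ρ φ) (rename ρ ψ)

module _ {m : ℕ} (cs : Vec ℤ m) where

  -- De Morgan's encoding yields a constructive disjunction because satisfaction is decidable.
  Sat-or : ∀ {V} (φ ψ : GapFormula V m) ν → Sat cs (φ or ψ) ν ⇔ (Sat cs φ ν ⊎ Sat cs ψ ν)
  Sat-or φ ψ ν = mk⇔ fwd (λ s (p , q) → [ p , q ]′ s)
    where
    fwd : Sat cs (φ or ψ) ν → Sat cs φ ν ⊎ Sat cs ψ ν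
    fwd h with sat? cs φ ν | sat? cs ψ ν
    ... | yes p | _ = inj₁ p
    ... | no _ | yes q = inj₂ q
    ... | no ¬p | no ¬q = contradiction (¬p , ¬q) h

  Sat-⋁ : ∀ {V} {A : Set} (F : A → GapFormula V m) as ν →
          Sat cs (⋁ F as) ν ⇔ Any (λ a → Sat cs (F a) ν) as
  Sat-⋁ F [] ν = mk⇔ (λ h → contradiction tt h) (λ ())
  Sat-⋁ F (a ∷ as) ν = ⇔-trans (Sat-or (F a) (⋁ F as) ν)
    (mk⇔ [ here , there ∘ to ih ]′ λ { (here p) → inj₁ p ; (there p) → inj₂ (from ih p) })
    where ih = Sat-⋁ F as ν

  Sat-⋀ : ∀ {V} (C : GapConstraint V m) ν → Sat cs (⋀ C) ν ⇔ SatConstraint cs ν C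
  Sat-⋀ [] ν = mk⇔ (λ _ → []) (λ _ → tt)
  Sat-⋀ (c ∷ C) ν = mk⇔ (λ (p , q) → p ∷ to ih q) (λ { (p ∷ q) → p , from ih q })
    where ih = Sat-⋀ C ν

  evalT-rename : ∀ {V W : Set} (ρ : V → W) (t : Term V m) ν →
                 evalT cs ν (renameT ρ t) ≡ evalT cs (ν ∘ ρ) t
  evalT-rename ρ (var x) ν = refl
  evalT-rename ρ (cst c) ν = refl

  Sat-rename : ∀ {V W : Set} (ρ : V → W) (φ : GapFormula V m) ν →
               Sat cs (rename ρ φ) ν ⇔ Sat cs φ (ν ∘ ρ)
  Sat-rename ρ tt ν = ⇔-refl
  Sat-rename ρ (cl (gap s t k)) ν =
    ≡⇒⇔ (cong₂ (λ a b → k ≤ a - b) (evalT-rename ρ s ν) (evalT-rename ρ t ν))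
  Sat-rename ρ (neg φ) ν = ¬-cong-⇔ (Sat-rename ρ φ ν)
  Sat-rename ρ (conj φ ψ) ν = Sat-rename ρ φ ν ×-⇔ Sat-rename ρ ψ ν

-- Quantifier elimination

-- Formulas in one distinguished variable z, all of whose atoms mentioning z
-- are of the form z ≥ t + k.
data Isolated (V : Set) (m : ℕ) : Set where
  rigid : GapFormula V m → Isolated V m
  above : Term V m → ℤ → Isolated V m
  neg   : Isolated V m → Isolated V m
  conj  : Isolated V m → Isolated V m → Isolated V m

isolateT : ∀ {V m} → Term (Maybe V) m → Maybe (Term V m)
isolateT (var (just x)) = just (var x)
isolateT (var nothing) = nothing
isolateT (cst c) = just (cst c)

isolateClause : ∀ {V m} → Maybe (Term V m) → Maybe (Term V m) → ℤ → Isolated V m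
isolateClause (just s) (just t) k = rigid (cl (gap s t k))
isolateClause nothing (just t) k = above t k
-- Over the integers s - z ≥ k says z ≤ s - k, which is the negation of z ≥ s + (1 - k).
isolateClause (just s) nothing k = neg (above s (1ℤ - k))
isolateClause nothing nothing k with k ≤? 0ℤ
... | yes _ = rigid tt
... | no _ = rigid ff

isolate : ∀ {V m} → GapFormula (Maybe V) m → Isolated V m
isolate tt = rigid tt
isolate (cl (gap s t k)) = isolateClause (isolateT s) (isolateT t) k
isolate (neg φ) = neg (isolate φ)
isolate (conj φ ψ) = conj (isolate φ) (isolate ψ)

breakpoints : ∀ {V m} → Isolated V m → List (Term V m × ℤ)
breakpoints (rigid φ) = []
breakpoints (above t k) = (t , k) ∷ []
breakpoints (neg θ) = breakpoints θ
breakpoints (conj θ χ) = breakpoints θ ++ breakpoints χ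

at-−∞ : ∀ {V m} → Isolated V m → GapFormula V m
at-−∞ (rigid φ) = φ
at-−∞ (above t k) = ff
at-−∞ (neg θ) = neg (at-−∞ θ)
at-−∞ (conj θ χ) = conj (at-−∞ θ) (at-−∞ χ)

at : ∀ {V m} → Isolated V m → Term V m × ℤ → GapFormula V m
at (rigid φ) b = φ
at (above t k) (s , j) = cl (gap s t (k - j))
at (neg θ) b = neg (at θ b)
at (conj θ χ) b = conj (at θ b) (at χ b)

-- The truth value of an isolated formula changes only at breakpoints, so it
-- suffices to test z = −∞ and each breakpoint.
eliminate : ∀ {V m} → GapFormula (Maybe V) m → GapFormula V m
eliminate φ = at-−∞ θ or ⋁ (at θ) (breakpoints θ)
  where θ = isolate φ

module _ {m : ℕ} (cs : Vec ℤ m) {V : Set} (ν : V → ℤ) where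

  value : Term V m × ℤ → ℤ
  value (t , k) = evalT cs ν t + k

  Holds : Isolated V m → ℤ → Set
  Holds (rigid φ) z = Sat cs φ ν
  Holds (above t k) z = value (t , k) ≤ z
  Holds (neg θ) z = ¬ Holds θ z
  Holds (conj θ χ) z = Holds θ z × Holds χ z

  valueT : Maybe (Term V m) → ℤ → ℤ
  valueT (just t) z = evalT cs ν t
  valueT nothing z = z

  evalT-isolate : ∀ (t : Term (Maybe V) m) z →
                  evalT cs (maybe′ ν z) t ≡ valueT (isolateT t) z
  evalT-isolate (var (just x)) z = refl
  evalT-isolate (var nothing) z = refl
  evalT-isolate (cst c) z = refl

  Holds-isolateClause : ∀ s t k z → (k ≤ valueT s z - valueT t z) ⇔ Holds (isolateClause s t k) z
  Holds-isolateClause (just s) (just t) k z = ⇔-refl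
  Holds-isolateClause nothing (just t) k z = nonneg-diff-⇔ (eq z (evalT cs ν t) k)
    where
    eq : ∀ z t k → (z - t) - k ≡ z - (t + k)
    eq = solve-∀
  Holds-isolateClause (just s) nothing k z =
    mk⇔ (λ p q → ℤ.<-irrefl refl (ℤ.<-≤-trans (ℤ.i≤pred[j]⇒i<j (nonneg-diff q (eq₁ z x k))) p))
        (λ h → nonneg-diff (ℤ.i<j⇒i≤pred[j] (ℤ.≰⇒> h)) (eq₂ z x k))
    where
    x = evalT cs ν s
    eq₁ : ∀ z s k → z - (s + (1ℤ - k)) ≡ (-1ℤ + k) - (s - z)
    eq₁ = solve-∀
    eq₂ : ∀ z s k → (-1ℤ + (s + (1ℤ - k))) - z ≡ (s - z) - k
    eq₂ = solve-∀
  Holds-isolateClause nothing nothing k z with k ≤? 0ℤ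
  ... | yes k≤0 = mk⇔ (λ _ → tt) (λ _ → subst (k ≤_) (sym (ℤ.+-inverseʳ z)) k≤0)
  ... | no k≰0 = mk⇔ (λ p _ → k≰0 (subst (k ≤_) (ℤ.+-inverseʳ z) p)) (λ h → contradiction tt h)

  Holds-isolate : ∀ φ z → Sat cs φ (maybe′ ν z) ⇔ Holds (isolate φ) z
  Holds-isolate tt z = ⇔-refl
  Holds-isolate (cl (gap s t k)) z =
    ⇔-trans (≡⇒⇔ (cong₂ (λ a b → k ≤ a - b) (evalT-isolate s z) (evalT-isolate t z)))
            (Holds-isolateClause (isolateT s) (isolateT t) k z)
  Holds-isolate (neg φ) z = ¬-cong-⇔ (Holds-isolate φ z)
  Holds-isolate (conj φ ψ) z = Holds-isolate φ z ×-⇔ Holds-isolate ψ z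

  Holds-cong : ∀ {z z′} θ → All (λ b → (value b ≤ z) ⇔ (value b ≤ z′)) (breakpoints θ) →
               Holds θ z ⇔ Holds θ z′
  Holds-cong (rigid φ) _ = ⇔-refl
  Holds-cong (above t k) (p ∷ []) = p
  Holds-cong (neg θ) ps = ¬-cong-⇔ (Holds-cong θ ps)
  Holds-cong (conj θ χ) ps =
    Holds-cong θ (All.++⁻ˡ (breakpoints θ) ps) ×-⇔ Holds-cong χ (All.++⁻ʳ (breakpoints θ) ps)

  Holds-at-−∞ : ∀ {z} θ → All (λ b → ¬ value b ≤ z) (breakpoints θ) →
                Sat cs (at-−∞ θ) ν ⇔ Holds θ z
  Holds-at-−∞ (rigid φ) _ = ⇔-refl
  Holds-at-−∞ (above t k) (p ∷ []) = mk⇔ (λ h → contradiction tt h) (λ q → contradiction q p)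
  Holds-at-−∞ (neg θ) ps = ¬-cong-⇔ (Holds-at-−∞ θ ps)
  Holds-at-−∞ (conj θ χ) ps =
    Holds-at-−∞ θ (All.++⁻ˡ (breakpoints θ) ps) ×-⇔ Holds-at-−∞ χ (All.++⁻ʳ (breakpoints θ) ps)

  Holds-at : ∀ θ b → Sat cs (at θ b) ν ⇔ Holds θ (value b)
  Holds-at (rigid φ) b = ⇔-refl
  Holds-at (above t k) (s , j) = nonneg-diff-⇔ (eq (evalT cs ν s) (evalT cs ν t) k j)
    where
    eq : ∀ s t k j → (s - t) - (k - j) ≡ (s + j) - (t + k)
    eq = solve-∀
  Holds-at (neg θ) b = ¬-cong-⇔ (Holds-at θ b)
  Holds-at (conj θ χ) b = Holds-at θ b ×-⇔ Holds-at χ b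

  NearestBelow : ℤ → List (Term V m × ℤ) → Term V m × ℤ → Set
  NearestBelow z bs b = value b ≤ z × All (λ b′ → value b′ ≤ z → value b′ ≤ value b) bs

  nearestBelow : ∀ z bs →
    All (λ b → ¬ value b ≤ z) bs ⊎ ∃ λ b → b ∈ bs × NearestBelow z bs b
  nearestBelow z [] = inj₁ []
  nearestBelow z (b ∷ bs) with value b ≤? z | nearestBelow z bs
  ... | no b≰z | inj₁ none = inj₁ (b≰z ∷ none)
  ... | no b≰z | inj₂ (c , c∈ , c≤z , max) = inj₂ (c , there c∈ , c≤z , (λ b≤z → contradiction b≤z b≰z) ∷ max)
  ... | yes b≤z | inj₁ none =
    inj₂ (b , here refl , b≤z , (λ _ → ℤ.≤-refl) ∷ All.map (λ n p → contradiction p n) none)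
  ... | yes b≤z | inj₂ (c , c∈ , c≤z , max) with ℤ.≤-total (value b) (value c)
  ...   | inj₁ b≤c = inj₂ (c , there c∈ , c≤z , (λ _ → b≤c) ∷ max)
  ...   | inj₂ c≤b = inj₂ (b , here refl , b≤z ,
                           (λ _ → ℤ.≤-refl) ∷ All.map (λ q p → ℤ.≤-trans (q p) c≤b) max)

  -- A witness for z = -∞. The 0ℤ seeds the minimum, so the empty list is covered too.
  low : List (Term V m × ℤ) → ℤ
  low bs = pred (min 0ℤ (map value bs))

  low-below : ∀ bs → All (λ b → ¬ value b ≤ low bs) bs
  low-below bs = All.map (λ p q → ℤ.<-irrefl refl (ℤ.≤-<-trans p (ℤ.i≤pred[j]⇒i<j q)))
                         (All.map⁻ (min≤xs 0ℤ (map value bs)))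

  Sat-eliminate : ∀ φ → Sat cs (eliminate φ) ν ⇔ (∃ λ z → Sat cs φ (maybe′ ν z))
  Sat-eliminate φ = ⇔-trans (Sat-or cs (at-−∞ θ) (⋁ (at θ) bs) ν)
    (mk⇔ [ sound₁ , sound₂ ∘ to (Sat-⋁ cs (at θ) bs ν) ]′
         (λ (z , p) → complete z (to (Holds-isolate φ z) p)))
    where
    θ = isolate φ
    bs = breakpoints θ
    sound₁ : Sat cs (at-−∞ θ) ν → ∃ λ z → Sat cs φ (maybe′ ν z)
    sound₁ p = low bs , from (Holds-isolate φ _) (to (Holds-at-−∞ θ (low-below bs)) p)
    sound₂ : Any (λ b → Sat cs (at θ b) ν) bs → ∃ λ z → Sat cs φ (maybe′ ν z)
    sound₂ p with Any.satisfied p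
    ... | b , q = value b , from (Holds-isolate φ _) (to (Holds-at θ b) q)
    complete : ∀ z → Holds θ z → Sat cs (at-−∞ θ) ν ⊎ Sat cs (⋁ (at θ) bs) ν
    complete z h with nearestBelow z bs
    ... | inj₁ none = inj₁ (from (Holds-at-−∞ θ none) h)
    ... | inj₂ (b , b∈ , b≤z , max) = inj₂ (from (Sat-⋁ cs (at θ) bs ν)
      (Any.map (λ { refl → from (Holds-at θ b) (to (Holds-cong θ same) h) }) b∈))
      where
      -- No breakpoint lies above `value b` and at or below z, so both points satisfy the same
      -- atoms.
      same = All.map (λ q → mk⇔ q (λ p → ℤ.≤-trans p b≤z)) max

peel : ∀ {V : Set} {k} → V ⊎ Fin (suc k) → Maybe (V ⊎ Fin k)
peel (inj₁ x) = just (inj₁ x)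
peel (inj₂ zero) = nothing
peel (inj₂ (suc i)) = just (inj₂ i)

eliminateAll : ∀ {V m} k → GapFormula (V ⊎ Fin k) m → GapFormula V m
eliminateAll zero φ = rename (λ { (inj₁ x) → x }) φ
eliminateAll (suc k) φ = eliminateAll k (eliminate (rename peel φ))

module _ {m : ℕ} (cs : Vec ℤ m) {V : Set} where

  Sat-eliminateAll : ∀ k (φ : GapFormula (V ⊎ Fin k) m) ν →
    Sat cs (eliminateAll k φ) ν ⇔ (∃ λ (μ : Fin k → ℤ) → Sat cs φ [ ν , μ ])
  Sat-eliminateAll zero φ ν = ⇔-trans (Sat-rename cs _ φ ν)
    (mk⇔ (λ p → (λ ()) , to (Sat-cong cs (λ { (inj₁ x) → refl }) φ) p)
         (λ (μ , p) → from (Sat-cong cs (λ { (inj₁ x) → refl }) φ) p))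
  Sat-eliminateAll (suc k) φ ν = ⇔-trans (Sat-eliminateAll k (eliminate (rename peel φ)) ν)
    (mk⇔ (λ (μ , p) → let z , q = to (Sat-eliminate cs _ (rename peel φ)) p in
             (λ { zero → z ; (suc i) → μ i }) ,
             to (Sat-cong cs (λ { (inj₁ x) → refl ; (inj₂ zero) → refl ; (inj₂ (suc i)) → refl }) φ)
                (to (Sat-rename cs peel φ _) q))
         (λ (μ , p) → (μ ∘ suc) , from (Sat-eliminate cs _ (rename peel φ)) (μ zero ,
             from (Sat-rename cs peel φ _)
               (to (Sat-cong cs (λ { (inj₁ x) → refl ; (inj₂ zero) → refl ; (inj₂ (suc i)) → refl }) φ) p))))

-- Eliminating every variable leaves a formula over ⊥, whose truth is computed at the empty
-- valuation.
satisfiable? : ∀ {k m} (cs : Vec ℤ m) (φ : GapFormula (Fin k) m) → Dec (∃ λ ν → Sat cs φ ν)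
satisfiable? {k} cs φ = Dec-map
  (⇔-trans (Sat-eliminateAll cs k (rename inj₂ φ) (λ ()))
    (mk⇔ (λ (μ , p) → μ , to (Sat-rename cs inj₂ φ _) p)
         (λ (μ , p) → μ , from (Sat-rename cs inj₂ φ _) p)))
  (sat? cs (eliminateAll {V = ⊥} k (rename inj₂ φ)) (λ ()))

-- Almost-full relations

-- Vytiniotis, Coquand and Wahlstedt's constructive form of "every infinite
-- sequence contains x before y with R x y".
data AlmostFull {X : Set} (R : X → X → Set) : Set₁ where
  now   : (∀ x y → R x y) → AlmostFull R
  later : (∀ x → AlmostFull (λ y z → R y z ⊎ R x y)) → AlmostFull R

meet : {T C D : Set} → T ⊎ C → T ⊎ D → T ⊎ (C × D)
meet (inj₁ t) _ = inj₁ t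
meet (inj₂ _) (inj₁ t) = inj₁ t
meet (inj₂ c) (inj₂ d) = inj₂ (c , d)

reassoc : {A B C : Set} → (A ⊎ B) ⊎ C → (A ⊎ C) ⊎ B
reassoc (inj₁ (inj₁ a)) = inj₁ (inj₁ a)
reassoc (inj₁ (inj₂ b)) = inj₂ b
reassoc (inj₂ c) = inj₁ (inj₂ c)

split : {T T′ C C′ : Set} → (T ⊎ C) ⊎ (T′ ⊎ C′) → ((T ⊎ T′) ⊎ C′) ⊎ C
split (inj₁ (inj₁ t)) = inj₁ (inj₁ (inj₁ t))
split (inj₁ (inj₂ c)) = inj₂ c
split (inj₂ (inj₁ t)) = inj₁ (inj₁ (inj₂ t))
split (inj₂ (inj₂ c)) = inj₁ (inj₂ c)

weaken : {T T′ C C′ : Set} → T ⊎ C → ((T ⊎ T′) ⊎ C′) ⊎ C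
weaken = Sum.map (inj₁ ∘ inj₁) id

module _ {X : Set} where

  infix 4 _⊆₂_
  _⊆₂_ : (R S : X → X → Set) → Set
  R ⊆₂ S = ∀ {x y} → R x y → S x y

  af-mono : ∀ {R S : X → X → Set} → R ⊆₂ S → AlmostFull R → AlmostFull S
  af-mono R⊆S (now all) = now (λ x y → R⊆S (all x y))
  af-mono R⊆S (later f) = later (λ x → af-mono [ inj₁ ∘ R⊆S , inj₂ ∘ R⊆S ]′ (f x))

  -- First of three stages towards closure under intersection, an intuitionistic Ramsey theorem. The
  -- parts to be intersected are nullary here, then unary, then binary: fixing the first element x
  -- lowers the arity by one, so each stage rests on the one before. T collects the outcomes already
  -- accepted.
  af-×₀ : ∀ {R S T : X → X → Set} {C D : Set} → AlmostFull R → AlmostFull S →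
          R ⊆₂ (λ y z → T y z ⊎ C) → S ⊆₂ (λ y z → T y z ⊎ D) →
          AlmostFull (λ y z → T y z ⊎ (C × D))
  af-×₀ (now all) s R⊆ S⊆ = af-mono (λ q → meet (R⊆ (all _ _)) (S⊆ q)) s
  af-×₀ {T = T} (later f) s R⊆ S⊆ = later λ x → af-mono
    (λ { (inj₁ (inj₁ t)) → inj₁ (inj₁ t) ; (inj₁ (inj₂ t)) → inj₂ (inj₁ t) ; (inj₂ cd) → inj₁ (inj₂ cd) })
    (af-×₀ {T = λ y z → T y z ⊎ T x y} (f x) s
      (λ { (inj₁ r) → [ inj₁ ∘ inj₁ , inj₂ ]′ (R⊆ r) ; (inj₂ r) → [ inj₁ ∘ inj₂ , inj₂ ]′ (R⊆ r) })
      ([ inj₁ ∘ inj₁ , inj₂ ]′ ∘ S⊆))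

  -- With x fixed, recursion into `f x` admits P x as an extra outcome, and recursion into `g x`
  -- admits Q x. These are propositions independent of y and z, and `af-×₀` joins them to P x × Q x.
  af-×₁ : ∀ {R S T : X → X → Set} {P Q : X → Set} → AlmostFull R → AlmostFull S →
          R ⊆₂ (λ y z → T y z ⊎ P y) → S ⊆₂ (λ y z → T y z ⊎ Q y) →
          AlmostFull (λ y z → T y z ⊎ (P y × Q y))
  af-×₁ (now all) s R⊆ S⊆ = af-mono (λ q → meet (R⊆ (all _ _)) (S⊆ q)) s
  af-×₁ r@(later _) (now all) R⊆ S⊆ = af-mono (λ q → meet (R⊆ q) (S⊆ (all _ _))) r
  af-×₁ {T = T} {P} {Q} (later f) (later g) R⊆ S⊆ = later λ x → af-mono
    (λ { (inj₁ (inj₁ (inj₁ t))) → inj₁ (inj₁ t)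
       ; (inj₁ (inj₁ (inj₂ t))) → inj₂ (inj₁ t)
       ; (inj₁ (inj₂ pq)) → inj₁ (inj₂ pq)
       ; (inj₂ pq) → inj₂ (inj₂ pq) })
    (af-×₀ {T = λ y z → (T y z ⊎ T x y) ⊎ (P y × Q y)}
      (af-×₁ {T = λ y z → (T y z ⊎ T x y) ⊎ P x} (f x) (later g) (split ∘ Sum.map R⊆ R⊆) (weaken ∘ S⊆))
      (af-×₁ {T = λ y z → (T y z ⊎ T x y) ⊎ Q x} (later f) (g x) (weaken ∘ R⊆) (split ∘ Sum.map S⊆ S⊆))
      reassoc reassoc)

  af-×₂ : ∀ {R S T A B : X → X → Set} → AlmostFull R → AlmostFull S →
          R ⊆₂ (λ y z → T y z ⊎ A y z) → S ⊆₂ (λ y z → T y z ⊎ B y z) →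
          AlmostFull (λ y z → T y z ⊎ (A y z × B y z))
  af-×₂ (now all) s R⊆ S⊆ = af-mono (λ q → meet (R⊆ (all _ _)) (S⊆ q)) s
  af-×₂ r@(later _) (now all) R⊆ S⊆ = af-mono (λ q → meet (R⊆ q) (S⊆ (all _ _))) r
  af-×₂ {T = T} {A} {B} (later f) (later g) R⊆ S⊆ = later λ x → af-mono
    (λ { (inj₁ (inj₁ (inj₁ t))) → inj₁ (inj₁ t)
       ; (inj₁ (inj₁ (inj₂ t))) → inj₂ (inj₁ t)
       ; (inj₁ (inj₂ pq)) → inj₁ (inj₂ pq)
       ; (inj₂ pq) → inj₂ (inj₂ pq) })
    (af-×₁ {T = λ y z → (T y z ⊎ T x y) ⊎ (A y z × B y z)}
      (af-×₂ {T = λ y z → (T y z ⊎ T x y) ⊎ A x y} (f x) (later g) (split ∘ Sum.map R⊆ R⊆) (weaken ∘ S⊆))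
      (af-×₂ {T = λ y z → (T y z ⊎ T x y) ⊎ B x y} (later f) (g x) (weaken ∘ R⊆) (split ∘ Sum.map S⊆ S⊆))
      reassoc reassoc)

  af-× : ∀ {R S : X → X → Set} → AlmostFull R → AlmostFull S →
         AlmostFull (λ x y → R x y × S x y)
  af-× r s = af-mono (λ { (inj₂ rs) → rs }) (af-×₂ {T = λ _ _ → ⊥} r s inj₂ inj₂)

  af-All : ∀ {I : Set} {R : I → X → X → Set} → (∀ i → AlmostFull (R i)) →
           ∀ is → AlmostFull (λ x y → All (λ i → R i x y) is)
  af-All af [] = now (λ _ _ → [])
  af-All af (i ∷ is) = af-mono (λ (r , rs) → r ∷ rs) (af-× (af i) (af-All af is))

af-preimage : ∀ {X Y : Set} {R : Y → Y → Set} (f : X → Y) → AlmostFull R →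
              AlmostFull (λ x y → R (f x) (f y))
af-preimage f (now all) = now (λ x y → all (f x) (f y))
af-preimage f (later g) = later (λ x → af-preimage f (g (f x)))

-- Well-founded descent: after x, the next element x′ is either at least x, which settles the
-- matter, or smaller, and then takes the place of x.
af-≤ : AlmostFull ℕ._≤_
af-≤ = later (λ x → below (<-wellFounded x))
  where
  below : ∀ {x} → Acc ℕ._<_ x → AlmostFull (λ y z → y ℕ.≤ z ⊎ x ℕ.≤ y)
  below {x} (acc rs) = later next
    where
    next : ∀ x′ → AlmostFull (λ y z → (y ℕ.≤ z ⊎ x ℕ.≤ y) ⊎ (x′ ℕ.≤ y ⊎ x ℕ.≤ x′))
    next x′ with x ℕ.≤? x′
    ... | yes x≤x′ = now (λ _ _ → inj₂ (inj₂ x≤x′))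
    ... | no x≰x′ = af-mono [ inj₁ ∘ inj₁ , inj₂ ∘ inj₁ ]′ (below (rs (ℕ.≰⇒> x≰x′)))

-- Expanding maps

-- The largest value reachable from x by upward hops of length at most K
-- through elements of Q.
cluster : ℕ → List ℤ → ℤ → ℤ
cluster K [] x = x
cluster K (q ∷ Q) x with q ≤? cluster K Q x + + K
... | yes _ = cluster K Q (q ⊔ cluster K Q x)
... | no _ = cluster K Q x

-- The number (2^l - 1) K. The recursion mirrors `cluster`: a cluster through Q, one hop of length
-- at most K, and a second cluster through Q.
spread : ℕ → ℕ → ℕ
spread K zero = 0
spread K (suc l) = spread K l ℕ.+ K ℕ.+ spread K l

module _ (K : ℕ) where

  i≤i+K : ∀ i → i ≤ i + + K
  i≤i+K i = ℤ.i≤i+j i (+ K)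

  cluster-≥ : ∀ Q x → x ≤ cluster K Q x
  cluster-≥ [] x = ℤ.≤-refl
  cluster-≥ (q ∷ Q) x with q ≤? cluster K Q x + + K
  ... | yes _ = ℤ.≤-trans (cluster-≥ Q x) (ℤ.≤-trans (ℤ.i≤j⊔i q _) (cluster-≥ Q _))
  ... | no _ = cluster-≥ Q x

  cluster-mono : ∀ Q {x y} → x ≤ y → cluster K Q x ≤ cluster K Q y
  cluster-mono [] x≤y = x≤y
  cluster-mono (q ∷ Q) {x} {y} x≤y with q ≤? cluster K Q x + + K | q ≤? cluster K Q y + + K
  ... | yes _ | yes _ = cluster-mono Q (ℤ.⊔-mono-≤ (ℤ.≤-refl {q}) (cluster-mono Q x≤y))
  ... | yes p | no ¬p = contradiction (ℤ.≤-trans p (ℤ.+-monoˡ-≤ (+ K) (cluster-mono Q x≤y))) ¬p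
  ... | no _ | yes _ = ℤ.≤-trans (cluster-mono Q x≤y) (ℤ.≤-trans (ℤ.i≤j⊔i q _) (cluster-≥ Q _))
  ... | no _ | no _ = cluster-mono Q x≤y

  Closed : List ℤ → ℤ → Set
  Closed Q x = All (λ q → q ≤ x + + K → q ≤ x) Q

  cluster-closed : ∀ Q x → Closed Q (cluster K Q x)
  cluster-closed [] x = []
  cluster-closed (q ∷ Q) x with q ≤? cluster K Q x + + K
  ... | yes _ = (λ _ → ℤ.≤-trans (ℤ.i≤i⊔j q _) (cluster-≥ Q _)) ∷ cluster-closed Q _
  ... | no ¬p = (λ p → contradiction p ¬p) ∷ cluster-closed Q x

  cluster-fixed : ∀ Q {x} → Closed Q x → cluster K Q x ≡ x
  cluster-fixed [] [] = refl
  cluster-fixed (q ∷ Q) {x} (c ∷ cs) with q ≤? cluster K Q x + + K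
  ... | no _ = cluster-fixed Q cs
  ... | yes p rewrite cluster-fixed Q cs | ℤ.i≤j⇒i⊔j≡j (c p) = cluster-fixed Q cs

  cluster-bound : ∀ Q x → cluster K Q x ≤ x + + spread K (length Q)
  cluster-bound [] x = ℤ.≤-reflexive (sym (ℤ.+-identityʳ x))
  cluster-bound (q ∷ Q) x with q ≤? cluster K Q x + + K
  ... | yes p = begin
    cluster K Q (q ⊔ cluster K Q x)  ≤⟨ cluster-bound Q _ ⟩
    (q ⊔ cluster K Q x) + + B        ≤⟨ ℤ.+-monoˡ-≤ (+ B) (ℤ.⊔-lub p (i≤i+K _)) ⟩
    (cluster K Q x + + K) + + B      ≤⟨ ℤ.+-monoˡ-≤ (+ B) (ℤ.+-monoˡ-≤ (+ K) (cluster-bound Q x)) ⟩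
    ((x + + B) + + K) + + B          ≡⟨ assoc x (+ B) (+ K) ⟩
    x + + (B ℕ.+ K ℕ.+ B)            ∎
    where
    open ℤ.≤-Reasoning
    B = spread K (length Q)
    assoc : ∀ x b k → ((x + b) + k) + b ≡ x + ((b + k) + b)
    assoc = solve-∀
  ... | no _ = ℤ.≤-trans (cluster-bound Q x) (ℤ.+-monoʳ-≤ x (+≤+ (ℕ.m≤n+m B (B ℕ.+ K))))
    where B = spread K (length Q)

  -- Since b is one hop from a, it is at most one hop from the top of the cluster of a. That top is
  -- closed, hence at least b and its own cluster top, and monotonicity gives both inequalities.
  cluster-≡ : ∀ Q {a b} → b ∈ Q → a ≤ b → b ≤ a + + K → cluster K Q a ≡ cluster K Q b
  cluster-≡ Q {a} {b} b∈Q a≤b b≤a+K = ℤ.≤-antisym (cluster-mono Q a≤b)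
    (subst (cluster K Q b ≤_) (cluster-fixed Q closed)
      (cluster-mono Q (All.lookup closed b∈Q
        (ℤ.≤-trans b≤a+K (ℤ.+-monoˡ-≤ (+ K) (cluster-≥ Q a))))))
    where closed = cluster-closed Q a

-- Extends displacements h, prescribed at the points u, to a monotone g on ℤ that is constant across
-- gaps of Q of length at most K. The demands are compatible because h is constant on points as
-- close together as a cluster can span.
module Interpolation {P : Set} (ps : List P) (complete : ∀ p → p ∈ ps)
                     (u h : P → ℤ) (K : ℕ) (Q : List ℤ)
                     (h-mono : ∀ p q → u p ≤ u q → h p ≤ h q)
                     (h-near : ∀ p q → u p ≤ u q → u q ≤ u p + + spread K (length Q) → h q ≤ h p)
                     where

  -- The value of `height` to the left of all points. Lying below every h p, it keeps the step
  -- function monotone.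
  bottom : ℤ
  bottom = min 0ℤ (map h ps)

  upTo : ℤ → List ℤ
  upTo y = map h (filter (λ p → u p ≤? y) ps)

  height : ℤ → ℤ
  height y = max bottom (upTo y)

  h≤height : ∀ {y} p → u p ≤ y → h p ≤ height y
  h≤height {y} p up≤y = All.lookup (xs≤max bottom (upTo y))
    (∈-map⁺ h (∈-filter⁺ (λ p → u p ≤? y) (complete p) up≤y))

  height≤ : ∀ {y c} → bottom ≤ c → (∀ p → u p ≤ y → h p ≤ c) → height y ≤ c
  height≤ {y} b≤c below =
    max≤v⁺ b≤c (All.map⁺ (All.map (below _) (All.all-filter (λ p → u p ≤? y) ps)))

  -- The jump of `height` at u p is moved left to the first x whose cluster reaches u p, so no jump
  -- separates two points with the same cluster top.
  g : ℤ → ℤ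
  g x = height (cluster K Q x)

  g-mono : ∀ {x y} → x ≤ y → g x ≤ g y
  g-mono x≤y = height≤ (⊥≤max bottom (upTo _))
    (λ p up≤ → h≤height p (ℤ.≤-trans up≤ (cluster-mono K Q x≤y)))

  g-cluster : ∀ {a b} → b ∈ Q → a ≤ b → b ≤ a + + K → g a ≡ g b
  g-cluster b∈Q a≤b b≤a+K = cong height (cluster-≡ K Q b∈Q a≤b b≤a+K)

  g-interpolates : ∀ p → g (u p) ≡ h p
  g-interpolates p = ℤ.≤-antisym
    (height≤ (All.lookup (min≤xs 0ℤ (map h ps)) (∈-map⁺ h (complete p))) below)
    (h≤height p (cluster-≥ K Q (u p)))
    where
    below : ∀ q → u q ≤ cluster K Q (u p) → h q ≤ h p
    below q uq≤ with ℤ.≤-total (u q) (u p)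
    ... | inj₁ uq≤up = h-mono q p uq≤up
    -- The cluster of u p extends at most `spread K (length Q)` beyond u p, which is the range
    -- covered by `h-near`.
    ... | inj₂ up≤uq = h-near p q up≤uq (ℤ.≤-trans uq≤ (cluster-bound K Q (u p)))

-- Differences truncated to natural numbers.

posPart : ℤ → ℕ
posPart (+ n) = n
posPart -[1+ n ] = 0

posPart-reflects-≤ : ∀ {d e} → ¬ d ≤ 0ℤ → posPart d ℕ.≤ posPart e → d ≤ e
posPart-reflects-≤ {+ suc n} {+ k} _ p = +≤+ p
posPart-reflects-≤ {+ suc n} { -[1+ k ]} _ ()
posPart-reflects-≤ {+ zero} d≰0 _ = contradiction ℤ.≤-refl d≰0
posPart-reflects-≤ { -[1+ n ]} d≰0 _ = contradiction -≤+ d≰0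

-- Truncated subtraction from `suc B` reverses the order as long as it is positive. Starting from
-- `suc B` rather than B keeps it positive at d = B, so that an e above B is still told apart from
-- B.
posPart-reflects-≥ : ∀ {B d e} → 0ℤ ≤ d → d ≤ + B →
                     suc B ℕ.∸ posPart d ℕ.≤ suc B ℕ.∸ posPart e → e ≤ d
posPart-reflects-≥ {e = -[1+ k ]} (+≤+ _) _ _ = -≤+
posPart-reflects-≥ {B} {+ n} {+ k} _ (+≤+ n≤B) p with k ℕ.≤? n
... | yes k≤n = +≤+ k≤n
... | no k≰n = contradiction p (ℕ.<⇒≱ (lemma (ℕ.≰⇒> k≰n) (ℕ.s≤s n≤B)))
  where
  lemma : ∀ {n k c} → n ℕ.< k → n ℕ.< c → c ℕ.∸ k ℕ.< c ℕ.∸ n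
  lemma {n} {k} {c} n<k n<c with ℕ.≤-total k c
  ... | inj₁ k≤c = ℕ.∸-monoʳ-< n<k k≤c
  ... | inj₂ c≤k = subst (ℕ._< c ℕ.∸ n) (sym (ℕ.m≤n⇒m∸n≡0 c≤k)) (ℕ.m<n⇒0<n∸m n<c)

terms : ∀ n m → List (Term (Fin n) m)
terms n m = map var (allFin n) ++ map cst (allFin m)

∈-terms : ∀ {n m} (t : Term (Fin n) m) → t ∈ terms n m
∈-terms (var x) = ∈-++⁺ˡ (∈-map⁺ var (∈-allFin x))
∈-terms (cst c) = ∈-++⁺ʳ _ (∈-map⁺ cst (∈-allFin c))

bound : ∀ {V m} → GapFormula V m → ℕ
bound tt = 0
bound (cl (gap s t k)) = ∣ k ∣
bound (neg φ) = bound φ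
bound (conj φ ψ) = bound φ ℕ.⊔ bound ψ

-- Satisfaction under expanding maps.

record Expanding {m} (cs : Vec ℤ m) (f : ℤ → ℤ) : Set where
  field
    fixes   : ∀ c → f (lookup cs c) ≡ lookup cs c
    expands : ∀ {x y} → x ≤ y → y - x ≤ f y - f x

IsometricUpTo : ∀ {V : Set} {m} → Vec ℤ m → ℕ → (ℤ → ℤ) → (V → ℤ) → Set
IsometricUpTo cs K f ν = ∀ s t → let a = evalT cs ν s ; b = evalT cs ν t in
  a ≤ b → b ≤ a + + K → f b - f a ≡ b - a

module _ {m : ℕ} {cs : Vec ℤ m} {f : ℤ → ℤ} (exp : Expanding cs f) where
  open Expanding exp

  evalT-∘ : ∀ {V} (ν : V → ℤ) t → evalT cs (f ∘ ν) t ≡ f (evalT cs ν t)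
  evalT-∘ ν (var x) = refl
  evalT-∘ ν (cst c) = sym (fixes c)

  -- A nonnegative bound puts the value of t at or below that of s, and expansion can only widen
  -- this gap. A negative bound would limit t - s from above, which expansion may violate.
  expand-positive : ∀ {V} (ν : V → ℤ) {c} → Positive c →
                    SatClause cs ν c → SatClause cs (f ∘ ν) c
  expand-positive ν {gap s t k} k≥0 k≤ =
    subst₂ (λ a b → k ≤ a - b) (sym (evalT-∘ ν s)) (sym (evalT-∘ ν t))
      (ℤ.≤-trans k≤ (expands (ℤ.0≤i-j⇒j≤i (ℤ.≤-trans k≥0 k≤))))

  expand-transition : ∀ {n} (ν ν′ : Fin n → ℤ) {C} → All Positive C →
    SatConstraint cs (ν ⊕ ν′) C → SatConstraint cs ((f ∘ ν) ⊕ (f ∘ ν′)) C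
  expand-transition ν ν′ {C} pos sat = to (Sat-⋀ cs C _)
    -- Mapping before or after pairing gives valuations that agree only pointwise, hence the detour
    -- through formulas.
    (to (Sat-cong cs {ν = f ∘ (ν ⊕ ν′)} (λ { (inj₁ x) → refl ; (inj₂ x) → refl }) (⋀ C))
      (from (Sat-⋀ cs C _)
        (All.zipWith (λ {c} (p , q) → expand-positive (ν ⊕ ν′) {c} p q) (pos , sat))))

  module _ (K : ℕ) {V : Set} {ν : V → ℤ} (isometric : IsometricUpTo cs K f ν) where

    -- Differences of size at most K are kept exactly. Larger ones keep their sign and do not shrink
    -- in size, so their comparison with a k of size at most K does not change.
    clause-invariant : ∀ c → ∣ GapClause.bound c ∣ ℕ.≤ K →
                       SatClause cs ν c ⇔ SatClause cs (f ∘ ν) c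
    clause-invariant (gap s t k) ∣k∣≤K = ⇔-trans core
      (≡⇒⇔ (sym (cong₂ (λ x y → k ≤ x - y) (evalT-∘ ν s) (evalT-∘ ν t))))
      where
      a = evalT cs ν s
      b = evalT cs ν t
      i≤∣i∣ : ∀ i → i ≤ + ∣ i ∣
      i≤∣i∣ (+ n) = ℤ.≤-refl
      i≤∣i∣ -[1+ n ] = -≤+
      k≤K : k ≤ + K
      k≤K = ℤ.≤-trans (i≤∣i∣ k) (+≤+ ∣k∣≤K)
      -k≤K : - k ≤ + K
      -k≤K = ℤ.≤-trans (i≤∣i∣ (- k)) (subst (λ n → + n ≤ + K) (sym (ℤ.∣-i∣≡∣i∣ k)) (+≤+ ∣k∣≤K))
      swap : ∀ x y → x - y ≡ - (y - x)
      swap = solve-∀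
      core : (k ≤ a - b) ⇔ (k ≤ f a - f b)
      core with ℤ.≤-total a b
      core | inj₁ a≤b with b ≤? a + + K
      ... | yes near = ≡⇒⇔ (cong (k ≤_) (trans (swap a b)
                         (trans (cong -_ (sym (isometric s t a≤b near))) (sym (swap (f a) (f b))))))
      ... | no far = mk⇔ (λ p → contradiction p absurd)
                         (λ p → contradiction (ℤ.≤-trans p shrink) absurd)
        where
        shrink : f a - f b ≤ a - b
        shrink = nonneg-diff (expands a≤b) (eq a b (f a) (f b))
          where
          eq : ∀ a b x y → (y - x) - (b - a) ≡ (a - b) - (x - y)
          eq = solve-∀
        absurd : ¬ (k ≤ a - b)
        absurd p = far (nonneg-diff (ℤ.≤-trans (ℤ.neg-mono-≤ p) -k≤K) (eq a b (+ K)))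
          where
          eq : ∀ a b K → K - (- (a - b)) ≡ (a + K) - b
          eq = solve-∀
      core | inj₂ b≤a with a ≤? b + + K
      ... | yes near = ≡⇒⇔ (cong (k ≤_) (sym (isometric t s b≤a near)))
      ... | no far = mk⇔ (λ p → ℤ.≤-trans p (expands b≤a)) (λ _ → ℤ.≤-trans k≤K large)
        where
        large : + K ≤ a - b
        large = nonneg-diff (ℤ.<⇒≤ (ℤ.≰⇒> far)) (eq a b (+ K))
          where
          eq : ∀ a b K → a - (b + K) ≡ (a - b) - K
          eq = solve-∀

    formula-invariant : ∀ φ → bound φ ℕ.≤ K → Sat cs φ ν ⇔ Sat cs φ (f ∘ ν)
    formula-invariant tt _ = ⇔-refl
    formula-invariant (cl c) b≤K = clause-invariant c b≤K
    formula-invariant (neg φ) b≤K = ¬-cong-⇔ (formula-invariant φ b≤K)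
    formula-invariant (conj φ ψ) b≤K =
      formula-invariant φ (ℕ.m⊔n≤o⇒m≤o _ _ b≤K) ×-⇔
      formula-invariant ψ (ℕ.m⊔n≤o⇒n≤o (bound φ) _ b≤K)

-- The almost-full relation on valuations and its expanding maps.

module _ {n m : ℕ} (cs : Vec ℤ m) where

  -- Natural-number values let almost-fullness of ≤ apply. Truncation loses nothing, since s and t
  -- are compared in both orders.
  separation : Term (Fin n) m → Term (Fin n) m → (Fin n → ℤ) → ℕ
  separation s t ν = posPart (evalT cs ν s - evalT cs ν t)

  -- The second inequality says that a separation of at most B is unchanged.
  SeparationGrows : ℕ → Term (Fin n) m → Term (Fin n) m → (ν μ : Fin n → ℤ) → Set
  SeparationGrows B s t ν μ =
    separation s t ν ℕ.≤ separation s t μ ×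
    suc B ℕ.∸ separation s t ν ℕ.≤ suc B ℕ.∸ separation s t μ

  infix 4 _⊑[_]_
  _⊑[_]_ : (Fin n → ℤ) → ℕ → (Fin n → ℤ) → Set
  ν ⊑[ B ] μ = All (λ s → All (λ t → SeparationGrows B s t ν μ) (terms n m)) (terms n m)

  -- A form of Dickson's lemma: the relation is a finite intersection of preimages of ≤ on ℕ.
  ⊑-almostFull : ∀ B → AlmostFull (λ ν μ → ν ⊑[ B ] μ)
  ⊑-almostFull B = af-All (λ s → af-All (λ t →
    af-× (af-preimage (separation s t) af-≤)
         (af-preimage (λ ν → suc B ℕ.∸ separation s t ν) af-≤)) (terms n m)) (terms n m)

  scale : ℕ → ℕ
  scale K = spread K (length (terms n m))

  -- The gaps of ν at which ν and μ differ exceed scale K, so by the choice of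
  -- scale each has a subgap longer than K free of terms of ν′, where the
  -- difference can be absorbed.
  stretch : ∀ K {ν μ} → ν ⊑[ scale K ] μ → ∀ ν′ → ∃ λ f →
            Expanding cs f × (f ∘ ν ≗ μ) ×
            (∀ φ → bound φ ℕ.≤ K → Sat cs φ ν′ ⇔ Sat cs φ (f ∘ ν′))
  stretch K {ν} {μ} ν⊑μ ν′ = f , expanding , (f-maps ∘ var) , formula-invariant expanding K isometric
    where
    u v h : Term (Fin n) m → ℤ
    u = evalT cs ν
    v = evalT cs μ
    -- The displacement that f has to realise at the point u p.
    h p = v p - u p

    Q : List ℤ
    Q = map (evalT cs ν′) (terms n m)

    grows : ∀ s t → SeparationGrows (scale K) s t ν μ
    grows s t = All.lookup (All.lookup ν⊑μ (∈-terms s)) (∈-terms t)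

    near : ∀ p q → u p ≤ u q → u q ≤ u p + + scale K → h q ≤ h p
    near p q up≤uq uq≤ = nonneg-diff
      (posPart-reflects-≥ {d = u q - u p} {e = v q - v p} (ℤ.i≤j⇒0≤j-i up≤uq)
        (nonneg-diff uq≤ (eq₁ (u q) (u p) (+ scale K))) (proj₂ (grows q p)))
      (eq₂ (u p) (u q) (v p) (v q))
      where
      eq₁ : ∀ x y b → (y + b) - x ≡ b - (x - y)
      eq₁ = solve-∀
      eq₂ : ∀ up uq vp vq → (uq - up) - (vq - vp) ≡ (vp - up) - (vq - uq)
      eq₂ = solve-∀

    mono : ∀ p q → u p ≤ u q → h p ≤ h q
    mono p q up≤uq with u q ≤? u p
    -- Here u p = u q. A zero difference is invisible to `posPart-reflects-≤`, but as a short gap it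
    -- is preserved by `near`.
    ... | yes uq≤up = near q p uq≤up (ℤ.≤-trans up≤uq (i≤i+K (scale K) (u q)))
    ... | no uq≰up = nonneg-diff
      (posPart-reflects-≤ {u q - u p} {v q - v p} (uq≰up ∘ ℤ.i-j≤0⇒i≤j) (proj₁ (grows q p)))
      (eq (u p) (u q) (v p) (v q))
      where
      eq : ∀ up uq vp vq → (vq - vp) - (uq - up) ≡ (vq - uq) - (vp - up)
      eq = solve-∀

    open Interpolation (terms n m) ∈-terms u h K Q mono
      (λ p q a b → near p q a
        (subst (λ l → u q ≤ u p + + spread K l) (length-map (evalT cs ν′) (terms n m)) b))

    -- Adding a monotone g makes f expanding, and constancy of g across short gaps of ν′ makes f
    -- isometric there.
    f : ℤ → ℤ
    f x = x + g x

    f-maps : ∀ p → f (u p) ≡ v p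
    f-maps p = trans (cong (λ y → u p + y) (g-interpolates p)) (eq (u p) (v p))
      where
      eq : ∀ x y → x + (y - x) ≡ y
      eq = solve-∀

    expanding : Expanding cs f
    expanding = record
      { fixes = λ c → f-maps (cst c)
      ; expands = λ {x} {y} x≤y → nonneg-diff (g-mono x≤y) (eq x y (g x) (g y))
      }
      where
      eq : ∀ x y a b → b - a ≡ ((y + b) - (x + a)) - (y - x)
      eq = solve-∀

    isometric : IsometricUpTo cs K f ν′
    isometric s t a≤b b≤a+K =
      trans (cong (λ y → f b - (a + y)) (g-cluster (∈-map⁺ (evalT cs ν′) (∈-terms t)) a≤b b≤a+K))
            (eq a b (g b))
      where
      a = evalT cs ν′ s
      b = evalT cs ν′ t
      eq : ∀ a b y → (b + y) - (a + y) ≡ b - a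
      eq = solve-∀

-- Predecessor formulas.

module _ (G : GCS) where
  open GCS G

  step-expand : ∀ {f} → Expanding consts f → ∀ a {ν ν′} →
                Step G a ν ν′ → Step G a (f ∘ ν) (f ∘ ν′)
  step-expand exp a {ν} {ν′} = go positive
    where
    go : ∀ {D} → All (λ Ca → All Positive (proj₁ Ca)) D →
         Any (λ Ca → SatConstraint consts (ν ⊕ ν′) (proj₁ Ca) × proj₂ Ca ≡ a) D → Any _ D
    go (pos ∷ _) (here (sat , eq)) = here (expand-transition exp ν ν′ pos sat , eq)
    go (_ ∷ poss) (there any) = there (go poss any)

  guarded : ∀ {V} {A : Set} → Dec A → GapFormula V m → GapFormula V m
  guarded (yes _) φ = φ
  guarded (no _) φ = ff

  Sat-guarded : ∀ {V} {A : Set} (A? : Dec A) (φ : GapFormula V m) ν →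
                Sat consts (guarded A? φ) ν ⇔ (Sat consts φ ν × A)
  Sat-guarded (yes a) φ ν = mk⇔ (λ p → p , a) proj₁
  Sat-guarded (no ¬a) φ ν = mk⇔ (λ h → contradiction tt h) (λ (_ , a) → contradiction a ¬a)

  transition : Act G → TransConstraint n m × Fin nAct → GapFormula (Fin n ⊎ Fin n) m
  transition a (C , b) = guarded (b ≟ a) (⋀ C)

  Sat-transitions : ∀ a ν ν′ → Sat consts (⋁ (transition a) Δ) (ν ⊕ ν′) ⇔ Step G a ν ν′
  Sat-transitions a ν ν′ = ⇔-trans (Sat-⋁ consts (transition a) Δ _)
    (mk⇔ (Any.map (λ {Cb} → to (one Cb))) (Any.map (λ {Cb} → from (one Cb))))
    where
    one : ∀ Cb → Sat consts (transition a Cb) (ν ⊕ ν′) ⇔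
                 (SatConstraint consts (ν ⊕ ν′) (proj₁ Cb) × proj₂ Cb ≡ a)
    one (C , b) = ⇔-trans (Sat-guarded (b ≟ a) (⋀ C) _) (Sat-⋀ consts C _ ×-⇔ ⇔-refl)

  pre : Act G → GapFormula (Fin n) m → GapFormula (Fin n) m
  pre a φ = eliminateAll n (conj (⋁ (transition a) Δ) (rename inj₂ φ))

  Sat-pre : ∀ a φ ν → Sat consts (pre a φ) ν ⇔ (Σ (Val G) λ ν′ → Step G a ν ν′ × Sat consts φ ν′)
  Sat-pre a φ ν = ⇔-trans (Sat-eliminateAll consts n _ ν)
    (mk⇔ (λ (ν′ , p) → ν′ , to (body ν′) p) (λ (ν′ , p) → ν′ , from (body ν′) p))
    where
    body : ∀ ν′ → Sat consts (conj (⋁ (transition a) Δ) (rename inj₂ φ)) [ ν , ν′ ] ⇔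
                  (Step G a ν ν′ × Sat consts φ ν′)
    body ν′ =
      ⇔-trans (Sat-cong consts (λ { (inj₁ x) → refl ; (inj₂ x) → refl }) (⋁ (transition a) Δ))
              (Sat-transitions a ν ν′)
      ×-⇔ Sat-rename consts inj₂ φ _

  preAny : GapFormula (Fin n) m → GapFormula (Fin n) m
  preAny φ = ⋁ (λ a → pre a φ) (allFin nAct)

  Sat-preAny : ∀ φ ν → Sat consts (preAny φ) ν ⇔
                       (Σ (Val G) λ ν′ → AnyStep G ν ν′ × Sat consts φ ν′)
  Sat-preAny φ ν = ⇔-trans (Sat-⋁ consts (λ a → pre a φ) (allFin nAct) ν)
    (mk⇔ (λ any → let a , p = Any.satisfied any ; ν′ , s , q = to (Sat-pre a φ ν) p in
            ν′ , (a , s) , q)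
         (λ (ν′ , (a , s) , q) →
            lose (∈-allFin a) (from (Sat-pre a φ ν) (ν′ , s , q))))

  -- Backward saturation and its termination.

  module Saturation (φ : GapFormula (Fin n) m) where

    within : ℕ → GapFormula (Fin n) m
    within zero = φ
    within (suc i) = within i or preAny (within i)

    U : ℕ → Val G → Set
    U i = Sat consts (within i)

    U-suc : ∀ i ν → U (suc i) ν ⇔ (U i ν ⊎ Σ (Val G) λ ν′ → AnyStep G ν ν′ × U i ν′)
    U-suc i ν = ⇔-trans (Sat-or consts (within i) _ ν) (⇔-refl ⊎-⇔ Sat-preAny (within i) ν)

    U-mono : ∀ {i j} → i ℕ.≤ j → ∀ {ν} → U i ν → U j ν
    U-mono = go ∘ ℕ.≤⇒≤′
      where
      go : ∀ {i j} → i ℕ.≤′ j → ∀ {ν} → U i ν → U j ν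
      go ℕ.≤′-refl p = p
      go (ℕ.≤′-step i≤j) p = from (U-suc _ _) (inj₁ (go i≤j p))

    U-sound : ∀ i {ν} → U i ν → Σ (Val G) λ ν′ → Reach G ν ν′ × Sat consts φ ν′
    U-sound zero {ν} p = ν , ε , p
    U-sound (suc i) {ν} p with to (U-suc i ν) p
    ... | inj₁ q = U-sound i q
    ... | inj₂ (_ , step , q) with U-sound i q
    ...   | ν′ , path , r = ν′ , step ◅ path , r

    -- f is quantified after ν′, the endpoint of a path from ν, because the map
    -- that stretch provides depends on ν′.
    U-endpoint : ∀ i {ν} → U i ν → Σ (Val G) λ ν′ → Sat consts φ ν′ ×
      (∀ f → Expanding consts f → Sat consts φ (f ∘ ν′) → U i (f ∘ ν))
    U-endpoint zero {ν} p = ν , p , λ _ _ q → q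
    U-endpoint (suc i) {ν} p with to (U-suc i ν) p
    ... | inj₁ q with U-endpoint i q
    ...   | ν′ , r , up = ν′ , r , λ f exp s → from (U-suc i _) (inj₁ (up f exp s))
    U-endpoint (suc i) {ν} p | inj₂ (ν₁ , (a , step) , q) with U-endpoint i q
    ...   | ν′ , r , up = ν′ , r , λ f exp s →
            from (U-suc i _) (inj₂ (f ∘ ν₁ , (a , step-expand exp a step) , up f exp s))

    infix 4 _⊑_
    -- The scale depends on φ alone and not on the stage i, so a single almost-full relation serves
    -- the whole chain.
    _⊑_ : Val G → Val G → Set
    ν ⊑ μ = _⊑[_]_ consts ν (scale {n} consts (bound φ)) μ

    -- One map f sends ν to μ, keeps the endpoint in Sat φ and preserves every step in between, so
    -- the image of the path witnesses membership of μ.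
    U-upward : ∀ i {ν μ} → ν ⊑ μ → U i ν → U i μ
    U-upward i ν⊑μ p with U-endpoint i p
    ... | ν′ , q , up with stretch consts (bound φ) ν⊑μ ν′
    ...   | f , exp , f∘ν≗μ , inv =
            to (Sat-cong consts f∘ν≗μ (within i)) (up f exp (to (inv φ ℕ.≤-refl) q))

    Stable : ℕ → Set
    Stable i = ∀ ν → U (suc i) ν → U i ν

    Fresh : ℕ → Val G → Set
    Fresh i ν = U (suc i) ν × ¬ U i ν

    stable-or-fresh : ∀ i → Stable i ⊎ ∃ (Fresh i)
    stable-or-fresh i with satisfiable? consts (conj (within (suc i)) (neg (within i)))
    ... | yes fresh = inj₂ fresh
    ... | no none = inj₁ λ ν p → decidable-stable (sat? consts (within i) ν) (λ q → none (ν , p , q))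

    -- The invariant carried through the unfolding of `AlmostFull`: S never leads from a valuation
    -- that enters after stage i and by stage `suc j` to one outside stage `suc j`.
    Progress : (Val G → Val G → Set) → ℕ → Set
    Progress S i = ∀ {j x y} → i ℕ.≤ j → U (suc j) x → ¬ U i x → ¬ U (suc j) y → ¬ S x y

    -- Each `later` consumes one fresh valuation and advances one stage. At `now`, fresh valuations
    -- of two consecutive stages would be related by S, against the invariant.
    stabilises : ∀ {S} → AlmostFull S → ∀ i → Progress S i → ∃ Stable
    stabilises (now all) i progress with stable-or-fresh i | stable-or-fresh (suc i)
    ... | inj₁ stable | _ = i , stable
    ... | inj₂ _ | inj₁ stable = suc i , stable
    ... | inj₂ (x , x∈ , x∉) | inj₂ (y , y∈ , y∉) =
      contradiction (all x y) (progress ℕ.≤-refl x∈ x∉ y∉)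
    stabilises {S} (later af) i progress with stable-or-fresh i
    ... | inj₁ stable = i , stable
    ... | inj₂ (x , x∈ , x∉) = stabilises (af x) (suc i) next
      where
      next : Progress (λ y z → S y z ⊎ S x y) (suc i)
      next i<j y∈ y∉ z∉ (inj₁ syz) =
        progress (ℕ.<⇒≤ i<j) y∈ (y∉ ∘ U-mono (ℕ.n≤1+n i)) z∉ syz
      -- Stage `suc i` contains x but not y, so the old invariant at j = i rules out S x y.
      next i<j y∈ y∉ z∉ (inj₂ sxy) = progress ℕ.≤-refl x∈ x∉ y∉ sxy

    fixpoint : ∃ Stable
    fixpoint = stabilises (⊑-almostFull consts (scale {n} consts (bound φ))) 0
      -- The initial invariant is upward closure of stage `suc j`.
      (λ _ x∈ _ y∉ x⊑y → y∉ (U-upward _ x⊑y x∈))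

    pre* : GapFormula (Fin n) m
    pre* = within (proj₁ fixpoint)

    pre*-complete : ∀ {ν ν′} → Reach G ν ν′ → Sat consts φ ν′ → Sat consts pre* ν
    pre*-complete ε p = U-mono ℕ.z≤n p
    pre*-complete (step ◅ path) p =
      proj₂ fixpoint _ (from (U-suc _ _) (inj₂ (_ , step , pre*-complete path p)))

    Sat-pre* : ∀ ν → Sat consts pre* ν ⇔ (Σ (Val G) λ ν′ → Reach G ν ν′ × Sat consts φ ν′)
    Sat-pre* ν = mk⇔ (U-sound (proj₁ fixpoint)) (λ (_ , path , p) → pre*-complete path p)

  -- Translation of EF formulae into gap formulas.

  define : EF G → GapFormula (Fin n) m
  define (clause c) = cl c
  define true = tt
  define (¬EF ψ) = neg (define ψ)
  define (ψ ∧EF χ) = conj (define ψ) (define χ)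
  define (⟨ a ⟩ ψ) = pre a (define ψ)
  define EF⟨ ψ ⟩ = Saturation.pre* (define ψ)

  Sat-define : ∀ ψ ν → Sat consts (define ψ) ν ⇔ ⟦_⟧ G ψ ν
  Sat-define (clause c) ν = ⇔-refl
  Sat-define true ν = ⇔-refl
  Sat-define (¬EF ψ) ν = ¬-cong-⇔ (Sat-define ψ ν)
  Sat-define (ψ ∧EF χ) ν = Sat-define ψ ν ×-⇔ Sat-define χ ν
  Sat-define (⟨ a ⟩ ψ) ν = ⇔-trans (Sat-pre a (define ψ) ν)
    (mk⇔ (λ (ν′ , s , p) → ν′ , s , to (Sat-define ψ ν′) p)
         (λ (ν′ , s , p) → ν′ , s , from (Sat-define ψ ν′) p))
  Sat-define EF⟨ ψ ⟩ ν = ⇔-trans (Saturation.Sat-pre* (define ψ) ν)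
    (mk⇔ (λ (ν′ , s , p) → ν′ , s , to (Sat-define ψ ν′) p)
         (λ (ν′ , s , p) → ν′ , s , from (Sat-define ψ ν′) p))

theorem2 : (G : GCS) →
    ((ψ : EF G) (ν : Val G) → Dec (⟦_⟧ G ψ ν)) ×
    ((ψ : EF G) → Σ (GapFormula (Fin (GCS.n G)) (GCS.m G))
    (λ φ → (ν : Val G) → Sat (GCS.consts G) φ ν ⇔ ⟦_⟧ G ψ ν))
theorem2 G =
  (λ ψ ν → Dec-map (Sat-define G ψ ν) (sat? (GCS.consts G) (define G ψ) ν)) ,
  (λ ψ → define G ψ , Sat-define G ψ)
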